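{- Let $d$ be a positive odd integer divisible by $3$, let $r$ be a positive odd integer, let $a$ be an integer with $a\equiv 1\pmod{12}$, and let $b=2^d a-3^r$. Then the equation $$ax^d-y^2-z^2+xyz-b=0$$ has no solution $(x,y,z)\in\mathbb{Z}^3$ with $x$ even. -}

module Defs where

-- Modulo 4 the equation reads y² + z² − xyz ≡ 3, because x² ∣ x ^ d, 4 ∣ 2 ^ d and 3 ^ r ≡ 3 (r is odd).
-- Since x is even, xyz modulo 4 depends only on the parities of x / 2, y and z, as do y² and z²;
-- none of the eight parity patterns gives the residue 3.
module Submission where

open import Defs
open import Data.Nat.Base as ℕ using (ℕ; zero; suc; _<_; s≤s; >-nonZero)
open import Data.Nat.Divisibility using (∣⇒≤; divides) renaming (_∣_ to _∣ℕ_)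
open import Data.Nat.DivMod using (_divMod_; result)
open import Data.Integer.Base using (ℤ; +_; 0ℤ; _+_; _-_; _*_; _^_)
open import Data.Integer.DivMod using (n%d<d; a≡a%n+[a/n]*n) renaming (_/_ to _/ℤ_; _%_ to _%ℤ_)
open import Data.Integer.Divisibility.Signed using (_∣_; divides; _∣?_; ∣m+n∣m⇒∣n)
open import Data.Integer.Properties using (+-identityʳ)
open import Data.Integer.Tactic.RingSolver using (solve-∀)
open import Data.Fin.Base using (Fin; toℕ; fromℕ<; zero; suc)
open import Data.Fin.Properties using (all?; toℕ-fromℕ<)
open import Data.Product.Base using (∃-syntax; _×_; _,_)
open import Relation.Nullary.Decidable using (¬?; from-yes)
open import Relation.Nullary.Negation.Core using (¬_; contradiction)
open import Relation.Binary.PropositionalEquality.Core using (_≡_; refl; sym; trans; cong; subst)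

parity : ∀ n → ∃[ p ] ∃[ k ] n ≡ + toℕ {2} p + k * + 2
parity n = fromℕ< n%2<2 , n /ℤ + 2 , trans (a≡a%n+[a/n]*n n (+ 2))
  (cong (λ m → + m + n /ℤ + 2 * + 2) (sym (toℕ-fromℕ< n%2<2)))
  where n%2<2 = n%d<d n (+ 2)

odd⇒≡1+k*2 : ∀ {n} → ¬ (2 ∣ℕ n) → ∃[ k ] n ≡ suc (k ℕ.* 2)
odd⇒≡1+k*2 {n} 2∤n with n divMod 2
... | result k zero       n≡ = contradiction (divides k n≡) 2∤n
... | result k (suc zero) n≡ = k , n≡

-- Each further pair of factors 3 multiplies by 9 ≡ 1 (mod 4); explicitly, 9(3 + 4m) = 3 + 4(6 +
-- 9m).
3^odd≡3[mod4] : ∀ k → ∃[ m ] (+ 3) ^ suc (k ℕ.* 2) ≡ + 3 + m * + 4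
3^odd≡3[mod4] zero = 0ℤ , refl
3^odd≡3[mod4] (suc k) with m , eq ← 3^odd≡3[mod4] k =
  + 6 + + 9 * m , trans (cong (λ t → + 3 * (+ 3 * t)) eq) (rearrange m)
  where
  rearrange : ∀ m → + 3 * (+ 3 * (+ 3 + m * + 4)) ≡ + 3 + (+ 6 + + 9 * m) * + 4
  rearrange = solve-∀

-- With x = 2w this is y² + z² - xyz - 3, which a solution would make divisible by 4.
form-3 : ℤ → ℤ → ℤ → ℤ
form-3 w y z = y * y + z * z - + 2 * w * y * z - + 3

-- Evaluation of a decision procedure settles the eight cases; the only values are -3, -2 and -1.
4∤form-3-on-bits : ∀ (v p q : Fin 2) → ¬ (+ 4 ∣ form-3 (+ toℕ v) (+ toℕ p) (+ toℕ q))
4∤form-3-on-bits = from-yes (all? λ (v : Fin 2) → all? λ (p : Fin 2) → all? λ (q : Fin 2) →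
  ¬? (+ 4 ∣? form-3 (+ toℕ v) (+ toℕ p) (+ toℕ q)))

-- Adding 2s to p changes p² by 4(ps + s²), and likewise for q. Even shifts change the triple
-- product by an even number, which the coefficient 2 turns into a multiple of 4.
form-3-reduce : ∀ v u p s q t → ∃[ k ]
  form-3 (v + u * + 2) (p + s * + 2) (q + t * + 2) ≡ k * + 4 + form-3 v p q
form-3-reduce v u p s q t =
  p * s + s * s + q * t + t * t
    - (v * p * t + v * s * q + u * p * q
       + + 2 * (v * s * t + u * p * t + u * s * q) + + 4 * (u * s * t)) ,
  expanded v u p s q t
  where
  expanded : ∀ v u p s q t →
    (p + s * + 2) * (p + s * + 2) + (q + t * + 2) * (q + t * + 2)
      - + 2 * (v + u * + 2) * (p + s * + 2) * (q + t * + 2) - + 3 ≡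
    (p * s + s * s + q * t + t * t
      - (v * p * t + v * s * q + u * p * q
         + + 2 * (v * s * t + u * p * t + u * s * q) + + 4 * (u * s * t))) * + 4
    + (p * p + q * q - + 2 * v * p * q - + 3)
  expanded = solve-∀

4∤form-3 : ∀ w y z → ¬ (+ 4 ∣ form-3 w y z)
4∤form-3 w y z 4∣ with parity w | parity y | parity z
... | v , u , refl | p , s , refl | q , t , refl
  with k , eq ← form-3-reduce (+ toℕ v) u (+ toℕ p) s (+ toℕ q) t =
  4∤form-3-on-bits v p q (∣m+n∣m⇒∣n (subst (+ 4 ∣_) eq 4∣) (divides k refl))

-- P, Q and 3 + m * 4 stand for 2 ^ (d - 2), x ^ (d - 2) and 3 ^ r, where x = w * 2.
equation-mod-4 : ∀ a w y z P Q m →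
  form-3 w y z + (a * (w * + 2 * (w * + 2 * Q)) - y ^ 2 - z ^ 2 + w * + 2 * y * z
    - (+ 2 * (+ 2 * P) * a - (+ 3 + m * + 4)))
  ≡ (a * w * w * Q - P * a + m) * + 4
-- `expanded` has the same type by definition, with `form-3` and the squares unfolded to plain ring
-- operations for the solver.
equation-mod-4 = expanded
  where
  expanded : ∀ a w y z P Q m →
    (y * y + z * z - + 2 * w * y * z - + 3) +
      (a * (w * + 2 * (w * + 2 * Q)) - y * (y * + 1) - z * (z * + 1) + w * + 2 * y * z
        - (+ 2 * (+ 2 * P) * a - (+ 3 + m * + 4)))
    ≡ (a * w * w * Q - P * a + m) * + 4
  expanded = solve-∀

corollary2p1 : (d : ℕ) → 0 < d → ¬ (2 ∣ℕ d) → 3 ∣ℕ d →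
    (r : ℕ) → 0 < r → ¬ (2 ∣ℕ r) →
    (a : ℤ) → + 12 ∣ (a - + 1) →
    (b : ℤ) → b ≡ (+ 2) ^ d * a - (+ 3) ^ r →
    ¬ (∃[ x ] ∃[ y ] ∃[ z ] ((+ 2 ∣ x) × (a * x ^ d - y ^ 2 - z ^ 2 + x * y * z - b ≡ 0ℤ)))
corollary2p1 d 0<d _ 3∣d r _ 2∤r a _ _ refl (_ , y , z , divides w refl , eq)
  -- From 3 ∣ d and d > 0 comes d ≥ 3, so d = e + 2, and `2 ^ d` and `x ^ d` each expose two
  -- factors.
  with s≤s (s≤s {n = e} _) ← ∣⇒≤ {{>-nonZero 0<d}} 3∣d
  with k , refl ← odd⇒≡1+k*2 2∤r
  with m , 3^r≡ ← 3^odd≡3[mod4] k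
  rewrite 3^r≡ =
  -- By `eq` the left side of the equation is 0, so adding it to `form-3 w y z` changes nothing,
  -- while `equation-mod-4` shows the sum to be a multiple of 4.
  4∤form-3 w y z (divides (a * w * w * Q - P * a + m)
    (trans (sym (+-identityʳ _))
      (trans (cong (_+_ (form-3 w y z)) (sym eq)) (equation-mod-4 a w y z P Q m))))
  where
  P = (+ 2) ^ e
  Q = (w * + 2) ^ e
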